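{- There is an effective method (algorithm) which, given any formula $\alpha\in\mathbf{For}$ and any finite set of formulas $\Gamma\subseteq\mathbf{For}$, determines in a finite number of steps whether or not $\alpha$ is an algebraic consequence of $\Gamma$, i.e. whether or not $\Gamma\models_{Alg}\alpha$.
   Context: Language. $\mathbf{VarProp}$ is a countable set of propositional variables. $\mathbf{For}$ is the least set containing $\mathbf{VarProp}$ and closed under the binary connectives $\wedge,\vee,\Rightarrow$ and the unary connectives $\neg,S_1,S_2$ (the freely generated set of formulas). HT-algebras. An $HT$-algebra is an algebra $A=(A,0,1,\wedge,\vee,\Rightarrow,\neg,S_1,S_2)$ such that $(A,0,1,\wedge,\vee,\Rightarrow,\neg)$ is a Heyting algebra (with $\neg a=a\Rightarrow 0$), and for all $a,b\in A$ and all $i,j\in\{1,2\}$: $S_i(a\wedge b)=S_ia\wedge S_ib$; $S_i(a\vee b)=S_ia\vee S_ib$; $S_2(a\Rightarrow b)=(S_2a\Rightarrow S_2b)$; $S_1(a\Rightarrow b)=(S_1a\Rightarrow S_1b)\wedge(S_2a\Rightarrow S_2b)$; $S_iS_ja=S_ja$; $S_1a\vee a=a$; $S_1a\vee\neg S_1a=1$. Algebraic semantics. An algebraic model is a pair $(A,h)$ where $A$ is an $HT$-algebra and $h:\mathbf{For}\to A$ is a homomorphism, i.e. $h$ preserves $\wedge,\vee,\Rightarrow,\neg,S_1,S_2$. $\Gamma\models_{Alg}\alpha$ means: for every algebraic model $(A,h)$, if $h(\gamma)=1$ for all $\gamma\in\Gamma$, then $h(\alpha)=1$. -}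

module Defs where

open import Algebra.Core using (Op₁)
open import Data.Nat.Base using (ℕ)
open import Level using (Level; _⊔_; suc)
open import Relation.Binary.Core using (_Preserves_⟶_)
open import Relation.Binary.Lattice.Bundles using (HeytingAlgebra)
import Relation.Binary.Lattice.Properties.HeytingAlgebra as HeytingProperties
open import Relation.Unary using (Pred; _∈_)

VarProp : Set
VarProp = ℕ

data Index : Set where
  one two : Index

infixr 5 _⇒_
infixr 6 _∨_
infixr 7 _∧_
infix  8 ¬_

data For : Set where
  var         : VarProp → For
  _∧_ _∨_ _⇒_ : For → For → For
  ¬_          : For → For
  S           : Index → For → For

-- 0 and 1 are the ⊥ and ⊤ of the Heyting algebra.  Its equality is a setoid
-- equality, so each S i is required to respect it.

record HTAlgebra (c ℓ₁ ℓ₂ : Level) : Set (suc (c ⊔ ℓ₁ ⊔ ℓ₂)) where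
  field
    heytingAlgebra : HeytingAlgebra c ℓ₁ ℓ₂

  open HeytingAlgebra heytingAlgebra public
    renaming (_∧_ to _∧ᴬ_; _∨_ to _∨ᴬ_; _⇨_ to _⇒ᴬ_)
  -- In the library, ¬ x is by definition x ⇨ ⊥.
  open HeytingProperties heytingAlgebra public
    using () renaming (¬_ to ¬ᴬ_)

  field
    Sᴬ      : Index → Op₁ Carrier
    S-cong  : ∀ i → Sᴬ i Preserves _≈_ ⟶ _≈_
    S-∧     : ∀ i a b → Sᴬ i (a ∧ᴬ b) ≈ (Sᴬ i a ∧ᴬ Sᴬ i b)
    S-∨     : ∀ i a b → Sᴬ i (a ∨ᴬ b) ≈ (Sᴬ i a ∨ᴬ Sᴬ i b)
    S₂-⇒    : ∀ a b → Sᴬ two (a ⇒ᴬ b) ≈ (Sᴬ two a ⇒ᴬ Sᴬ two b)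
    S₁-⇒    : ∀ a b → Sᴬ one (a ⇒ᴬ b)
                    ≈ ((Sᴬ one a ⇒ᴬ Sᴬ one b) ∧ᴬ (Sᴬ two a ⇒ᴬ Sᴬ two b))
    S-S     : ∀ i j a → Sᴬ i (Sᴬ j a) ≈ Sᴬ j a
    S₁-∨    : ∀ a → (Sᴬ one a ∨ᴬ a) ≈ a
    S₁-∨-¬  : ∀ a → (Sᴬ one a ∨ᴬ (¬ᴬ (Sᴬ one a))) ≈ ⊤

record AlgebraicModel (c ℓ₁ ℓ₂ : Level) : Set (suc (c ⊔ ℓ₁ ⊔ ℓ₂)) where
  field
    algebra : HTAlgebra c ℓ₁ ℓ₂

  open HTAlgebra algebra public

  field
    h   : For → Carrier
    h-∧ : ∀ α β → h (α ∧ β) ≈ (h α ∧ᴬ h β)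
    h-∨ : ∀ α β → h (α ∨ β) ≈ (h α ∨ᴬ h β)
    h-⇒ : ∀ α β → h (α ⇒ β) ≈ (h α ⇒ᴬ h β)
    h-¬ : ∀ α → h (¬ α) ≈ (¬ᴬ (h α))
    h-S : ∀ i α → h (S i α) ≈ Sᴬ i (h α)

-- Algebraic consequence Γ ⊨ α for an arbitrary Γ ⊆ For; the levels are those
-- of the algebras quantified over.

AlgConsequence : ∀ (c ℓ₁ ℓ₂ : Level) {p} → Pred For p → For →
                 Set (suc (c ⊔ ℓ₁ ⊔ ℓ₂) ⊔ p)
AlgConsequence c ℓ₁ ℓ₂ Γ α =
  (M : AlgebraicModel c ℓ₁ ℓ₂) → let open AlgebraicModel M in
  (∀ γ → γ ∈ Γ → h γ ≈ ⊤) → h α ≈ ⊤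

{-# OPTIONS --safe #-}

-- The operators S i take complemented values and jointly determine an element,
-- so inside any HT-algebra the top element is covered by pieces on each of
-- which finitely many given elements behave as constants of the three-element
-- chain 0 < ½ < 1.  On such a piece every formula takes the value computed in
-- the chain, hence Γ ⊨ α holds as soon as it holds for the finitely many
-- chain-valued valuations of the variables that occur.

module Submission where

open import Defs
open import Data.Bool.Base using (Bool; true; false; not; if_then_else_)
  renaming (_∧_ to _&&_; _∨_ to _||_)
import Data.Bool.Properties as Bool
open import Data.Empty using (⊥-elim)
open import Data.Fin.Base as Fin using (Fin)
open import Data.Fin.Patterns using (0F; 1F; 2F)
import Data.Fin.Properties as Fin
open import Data.List.Base using (List; _∷_; map)
open import Data.List.Extrema.Nat using (max; xs≤max)
open import Data.List.Membership.Propositional using (_∈_; find)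
open import Data.List.Membership.Propositional.Properties using (∈-map⁺)
open import Data.List.Relation.Unary.All as All using (All)
open import Data.List.Relation.Unary.All.Properties using (¬All⇒Any¬)
open import Data.List.Relation.Unary.Any using (here; there)
open import Data.Nat.Base as ℕ using (ℕ; zero; suc; s<s)
open import Data.Nat.Properties using (m⊔n≤o⇒m≤o; m⊔n≤o⇒n≤o)
open import Data.Product.Base using (_,_)
open import Function.Base using (_∘_; const)
open import Level using (Level; Lift; lift; lower)
import Relation.Binary.Lattice.Properties.HeytingAlgebra as HeytingProperties
open import Relation.Binary.Lattice.Definitions
  using (Supremum; Infimum; Exponential)
open import Relation.Binary.PropositionalEquality as ≡ using (_≡_; _≢_; cong)
open import Relation.Nullary using (Dec; yes; no)
open import Relation.Nullary.Decidable
  using (does; from-yes; map′; _×-dec_; _→-dec_)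

-- The three-element chain and its operations.

-- 0F, 1F and 2F stand for 0, ½ and 1.
Three : Set
Three = Fin 3

infixr 5 _⇒ᵀ_
infixr 6 _∨ᵀ_
infixr 7 _∧ᵀ_

_∧ᵀ_ _∨ᵀ_ _⇒ᵀ_ : Three → Three → Three
x ∧ᵀ y = if does (x Fin.≤? y) then x else y
x ∨ᵀ y = if does (x Fin.≤? y) then y else x
x ⇒ᵀ y = if does (x Fin.≤? y) then 2F else y

-- The two bits, `x = 1` and `x ≠ 0`, determine `x` together; they are what the two operators see of
-- it.
at : Index → Three → Bool
at one x = does (x Fin.≟ 2F)
at two x = not (does (x Fin.≟ 0F))

Sᵀ : Index → Three → Three
Sᵀ i x = if at i x then 2F else 0F

-- The chain is finite, so all triples can be checked, and `from-yes` extracts the proof from the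
-- check.
∨ᵀ-supremum : Supremum Fin._≤_ _∨ᵀ_
∨ᵀ-supremum = from-yes (Fin.all? λ x → Fin.all? λ y →
  (x Fin.≤? (x ∨ᵀ y)) ×-dec (y Fin.≤? (x ∨ᵀ y)) ×-dec
  Fin.all? λ (z : Three) → (x Fin.≤? z) →-dec (y Fin.≤? z) →-dec ((x ∨ᵀ y) Fin.≤? z))

∧ᵀ-infimum : Infimum Fin._≤_ _∧ᵀ_
∧ᵀ-infimum = from-yes (Fin.all? λ x → Fin.all? λ y →
  ((x ∧ᵀ y) Fin.≤? x) ×-dec ((x ∧ᵀ y) Fin.≤? y) ×-dec
  Fin.all? λ (z : Three) → (z Fin.≤? x) →-dec (z Fin.≤? y) →-dec (z Fin.≤? (x ∧ᵀ y)))

⇒ᵀ-exponential : Exponential Fin._≤_ _∧ᵀ_ _⇒ᵀ_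
⇒ᵀ-exponential = from-yes (Fin.all? λ w → Fin.all? λ x → Fin.all? λ y →
  (((w ∧ᵀ x) Fin.≤? y) →-dec (w Fin.≤? (x ⇒ᵀ y))) ×-dec
  ((w Fin.≤? (x ⇒ᵀ y)) →-dec ((w ∧ᵀ x) Fin.≤? y)))

all-indices? : ∀ {p} {P : Index → Set p} → (∀ i → Dec (P i)) → Dec (∀ i → P i)
all-indices? P? = map′ (λ (p , q) → λ { one → p ; two → q })
  (λ f → f one , f two) (P? one ×-dec P? two)

at-∧ : ∀ i x y → at i (x ∧ᵀ y) ≡ (at i x && at i y)
at-∧ = from-yes (all-indices? λ i → Fin.all? λ x → Fin.all? λ y →
  at i (x ∧ᵀ y) Bool.≟ (at i x && at i y))

at-∨ : ∀ i x y → at i (x ∨ᵀ y) ≡ (at i x || at i y)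
at-∨ = from-yes (all-indices? λ i → Fin.all? λ x → Fin.all? λ y →
  at i (x ∨ᵀ y) Bool.≟ (at i x || at i y))

at-two-⇒ : ∀ x y → at two (x ⇒ᵀ y) ≡ (not (at two x) || at two y)
at-two-⇒ = from-yes (Fin.all? λ x → Fin.all? λ y →
  at two (x ⇒ᵀ y) Bool.≟ (not (at two x) || at two y))

-- Mirrors the axiom `S₁-⇒`. The second conjunct catches ½ ⇒ 0 = 0, where the first one is true.
at-one-⇒ : ∀ x y → at one (x ⇒ᵀ y) ≡
           ((not (at one x) || at one y) && (not (at two x) || at two y))
at-one-⇒ = from-yes (Fin.all? λ x → Fin.all? λ y →
  at one (x ⇒ᵀ y) Bool.≟
  ((not (at one x) || at one y) && (not (at two x) || at two y)))

at-S : ∀ i j x → at i (Sᵀ j x) ≡ at j x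
at-S one j x with at j x
... | true  = ≡.refl
... | false = ≡.refl
at-S two j x with at j x
... | true  = ≡.refl
... | false = ≡.refl

at-one-≢2F : ∀ x → x ≢ 2F → at one x ≡ false
at-one-≢2F 0F _    = ≡.refl
at-one-≢2F 1F _    = ≡.refl
at-one-≢2F 2F 2≢2 = ⊥-elim (2≢2 ≡.refl)

-- Valuations in the chain and the models they define.

Valuation : Set
Valuation = VarProp → Three

eval : Valuation → For → Three
eval v (var p) = v p
eval v (α ∧ β) = eval v α ∧ᵀ eval v β
eval v (α ∨ β) = eval v α ∨ᵀ eval v β
eval v (α ⇒ β) = eval v α ⇒ᵀ eval v β
eval v (¬ α)   = eval v α ⇒ᵀ 0F
eval v (S i α) = Sᵀ i (eval v α)

module _ (c ℓ₁ ℓ₂ : Level) where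

  -- Lifted, so that the chain is among the algebras over which `AlgConsequence` ranges at the given
  -- levels.
  three : HTAlgebra c ℓ₁ ℓ₂
  three = record
    { heytingAlgebra = record
      { Carrier = Lift c Three
      ; _≈_     = λ x y → Lift ℓ₁ (lower x ≡ lower y)
      ; _≤_     = λ x y → Lift ℓ₂ (lower x Fin.≤ lower y)
      ; _∨_     = λ x y → lift (lower x ∨ᵀ lower y)
      ; _∧_     = λ x y → lift (lower x ∧ᵀ lower y)
      ; _⇨_     = λ x y → lift (lower x ⇒ᵀ lower y)
      ; ⊤       = lift 2F
      ; ⊥       = lift 0F
      ; isHeytingAlgebra = record
        { isBoundedLattice = record
          { isLattice = record
            { isPartialOrder = record
              { isPreorder = record
                { isEquivalence = record
                  { refl  = lift ≡.refl
                  ; sym   = λ p → lift (≡.sym (lower p))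
                  ; trans = λ p q → lift (≡.trans (lower p) (lower q))
                  }
                ; reflexive = λ p → lift (Fin.≤-reflexive (lower p))
                ; trans     = λ p q → lift (Fin.≤-trans (lower p) (lower q))
                }
              ; antisym = λ p q → lift (Fin.≤-antisym (lower p) (lower q))
              }
            ; supremum = λ x y →
                let x≤ , y≤ , least = ∨ᵀ-supremum (lower x) (lower y) in
                lift x≤ , lift y≤ ,
                λ z p q → lift (least (lower z) (lower p) (lower q))
            ; infimum = λ x y →
                let ≤x , ≤y , greatest = ∧ᵀ-infimum (lower x) (lower y) in
                lift ≤x , lift ≤y ,
                λ z p q → lift (greatest (lower z) (lower p) (lower q))
            }
          ; maximum = λ x → lift (Fin.≤fromℕ (lower x))
          ; minimum = λ _ → lift ℕ.z≤n
          }
        ; exponential = λ w x y →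
            let to , from = ⇒ᵀ-exponential (lower w) (lower x) (lower y) in
            (λ p → lift (to (lower p))) , (λ p → lift (from (lower p)))
        }
      }
    ; Sᴬ     = λ i x → lift (Sᵀ i (lower x))
    ; S-cong = λ i p → lift (cong (Sᵀ i) (lower p))
    ; S-∧    = λ i x y → lift (S-∧ i (lower x) (lower y))
    ; S-∨    = λ i x y → lift (S-∨ i (lower x) (lower y))
    ; S₂-⇒   = λ x y → lift (S₂-⇒ (lower x) (lower y))
    ; S₁-⇒   = λ x y → lift (S₁-⇒ (lower x) (lower y))
    ; S-S    = λ i j x → lift (cong (λ b → if b then 2F else 0F) (at-S i j (lower x)))
    ; S₁-∨   = λ x → lift (S₁-∨ (lower x))
    ; S₁-∨-¬ = λ x → lift (S₁-∨-¬ (lower x))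
    }
    where
    S-∧ : ∀ i x y → Sᵀ i (x ∧ᵀ y) ≡ (Sᵀ i x ∧ᵀ Sᵀ i y)
    S-∧ = from-yes (all-indices? λ i → Fin.all? λ x → Fin.all? λ y →
      Sᵀ i (x ∧ᵀ y) Fin.≟ (Sᵀ i x ∧ᵀ Sᵀ i y))

    S-∨ : ∀ i x y → Sᵀ i (x ∨ᵀ y) ≡ (Sᵀ i x ∨ᵀ Sᵀ i y)
    S-∨ = from-yes (all-indices? λ i → Fin.all? λ x → Fin.all? λ y →
      Sᵀ i (x ∨ᵀ y) Fin.≟ (Sᵀ i x ∨ᵀ Sᵀ i y))

    S₂-⇒ : ∀ x y → Sᵀ two (x ⇒ᵀ y) ≡ (Sᵀ two x ⇒ᵀ Sᵀ two y)
    S₂-⇒ = from-yes (Fin.all? λ x → Fin.all? λ y →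
      Sᵀ two (x ⇒ᵀ y) Fin.≟ (Sᵀ two x ⇒ᵀ Sᵀ two y))

    S₁-⇒ : ∀ x y → Sᵀ one (x ⇒ᵀ y) ≡
           ((Sᵀ one x ⇒ᵀ Sᵀ one y) ∧ᵀ (Sᵀ two x ⇒ᵀ Sᵀ two y))
    S₁-⇒ = from-yes (Fin.all? λ x → Fin.all? λ y →
      Sᵀ one (x ⇒ᵀ y) Fin.≟
      ((Sᵀ one x ⇒ᵀ Sᵀ one y) ∧ᵀ (Sᵀ two x ⇒ᵀ Sᵀ two y)))

    S₁-∨ : ∀ x → (Sᵀ one x ∨ᵀ x) ≡ x
    S₁-∨ = from-yes (Fin.all? λ x →
      (Sᵀ one x ∨ᵀ x) Fin.≟ x)

    S₁-∨-¬ : ∀ x → (Sᵀ one x ∨ᵀ (Sᵀ one x ⇒ᵀ 0F)) ≡ 2F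
    S₁-∨-¬ = from-yes (Fin.all? λ x →
      (Sᵀ one x ∨ᵀ (Sᵀ one x ⇒ᵀ 0F)) Fin.≟ 2F)

  threeModel : Valuation → AlgebraicModel c ℓ₁ ℓ₂
  threeModel v = record
    { algebra = three
    ; h   = λ α → lift (eval v α)
    ; h-∧ = λ _ _ → lift ≡.refl
    ; h-∨ = λ _ _ → lift ≡.refl
    ; h-⇒ = λ _ _ → lift ≡.refl
    ; h-¬ = λ _ → lift ≡.refl
    ; h-S = λ _ _ → lift ≡.refl
    }

-- Quantification over finitely many valuations.

infixr 5 _◂_
_◂_ : ∀ {a} {A : Set a} → A → (ℕ → A) → ℕ → A
(t ◂ v) zero    = t
(t ◂ v) (suc p) = v p

-- The variables from n on are given the dummy value 0.
Every : ∀ {ℓ} → ℕ → (Valuation → Set ℓ) → Set ℓ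
Every zero    P = P (const 0F)
Every (suc n) P = ∀ t → Every n (λ v → P (t ◂ v))

every : ∀ n {p} {P : Valuation → Set p} → (∀ v → P v) → Every n P
every zero    f   = f _
every (suc n) f t = every n (f ∘ (t ◂_))

Every-map : ∀ n {p q} {P : Valuation → Set p} {Q : Valuation → Set q} →
            (∀ v → P v → Q v) → Every n P → Every n Q
Every-map zero    f e   = f _ e
Every-map (suc n) f e t = Every-map n (f ∘ (t ◂_)) (e t)

every? : ∀ n {p} {P : Valuation → Set p} → (∀ v → Dec (P v)) → Dec (Every n P)
every? zero    P? = P? _
every? (suc n) P? = Fin.all? λ t → every? n (P? ∘ (t ◂_))

bound : For → ℕ
-- One above the index, so that `bound α ≤ n` puts every variable of `α` strictly below `n`.
bound (var p) = suc p
bound (α ∧ β) = bound α ℕ.⊔ bound β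
bound (α ∨ β) = bound α ℕ.⊔ bound β
bound (α ⇒ β) = bound α ℕ.⊔ bound β
bound (¬ α)   = bound α
bound (S i α) = bound α

-- Boolean values relative to an element of an HT-algebra.

module _ {c ℓ₁ ℓ₂} (A : HTAlgebra c ℓ₁ ℓ₂) where
  open HTAlgebra A
  open HeytingProperties heytingAlgebra
    using (⇨-eval; ⇨-relax; ⇨-unit; y≤x⇨y)

  -- Truth on the piece `e`: for `false`, `x` is disjoint from `e`.
  Decides : Carrier → Bool → Carrier → Set ℓ₂
  Decides e true  x = e ≤ x
  Decides e false x = e ≤ ¬ᴬ x

  contradictory : ∀ {e x y} → e ≤ x → e ≤ ¬ᴬ x → e ≤ y
  contradictory e≤x e≤¬x =
    trans (∧-greatest e≤¬x e≤x) (trans ⇨-eval (minimum _))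

  -- Contraposition on the piece `e`.
  ¬-intro : ∀ {e x y} → e ∧ᴬ x ≤ y → e ≤ ¬ᴬ y → e ≤ ¬ᴬ x
  ¬-intro e∧x≤y e≤¬y =
    transpose-⇨ (contradictory e∧x≤y (trans (x∧y≤x _ _) e≤¬y))

  Decides-≤ : ∀ {e f} b {x} → e ≤ f → Decides f b x → Decides e b x
  Decides-≤ true  e≤f d = trans e≤f d
  Decides-≤ false e≤f d = trans e≤f d

  Decides-≈ : ∀ {e} b {x y} → x ≈ y → Decides e b x → Decides e b y
  Decides-≈ true  x≈y d = trans d (reflexive x≈y)
  Decides-≈ false x≈y d =
    ¬-intro (trans (x∧y≤y _ _) (reflexive (Eq.sym x≈y))) d

  Decides-∧ : ∀ {e} a b {x y} → Decides e a x → Decides e b y →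
              Decides e (a && b) (x ∧ᴬ y)
  Decides-∧ true  true  d f = ∧-greatest d f
  Decides-∧ true  false d f = ¬-intro (trans (x∧y≤y _ _) (x∧y≤y _ _)) f
  Decides-∧ false b     d f = ¬-intro (trans (x∧y≤y _ _) (x∧y≤x _ _)) d

  Decides-∨ : ∀ {e} a b {x y} → Decides e a x → Decides e b y →
              Decides e (a || b) (x ∨ᴬ y)
  Decides-∨ true  b     d f = trans d (x≤x∨y _ _)
  Decides-∨ false true  d f = trans f (y≤x∨y _ _)
  -- Disjointness is symmetric, so the join can be moved to the left of `≤`, where `∨-least`
  -- applies.
  Decides-∨ false false d f = swap (∨-least (swap d) (swap f))
    where
    swap : ∀ {x y} → x ≤ ¬ᴬ y → y ≤ ¬ᴬ x
    swap x≤¬y = transpose-⇨ (trans (∧-greatest (x∧y≤y _ _) (x∧y≤x _ _))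
                                   (transpose-∧ x≤¬y))

  Decides-⇒ : ∀ {e} a b {x y} → Decides e a x → Decides e b y →
              Decides e (not a || b) (x ⇒ᴬ y)
  Decides-⇒ true  true  d f = trans f y≤x⇨y
  Decides-⇒ true  false d f =
    ¬-intro (trans (∧-greatest (x∧y≤y _ _) (trans (x∧y≤x _ _) d)) ⇨-eval) f
  Decides-⇒ false b     d f = trans d (⇨-relax refl (minimum _))

  -- By residuation both `x` and its negation lie below `e ⇒ᴬ d`, hence so does their join `⊤`.
  split-on : ∀ {e d x} → x ∨ᴬ (¬ᴬ x) ≈ ⊤ →
             e ∧ᴬ x ≤ d → e ∧ᴬ (¬ᴬ x) ≤ d → e ≤ d
  split-on {e} x∨¬x≈⊤ e∧x≤d e∧¬x≤d =
    trans (∧-greatest (trans (maximum _) (reflexive (Eq.sym x∨¬x≈⊤))) refl)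
      (transpose-∧ (∨-least (swap e∧x≤d) (swap e∧¬x≤d)))
    where
    swap : ∀ {x y} → e ∧ᴬ x ≤ y → x ≤ e ⇒ᴬ y
    swap e∧x≤y = transpose-⇨ (trans (∧-greatest (x∧y≤y _ _) (x∧y≤x _ _)) e∧x≤y)

  -- Order properties of the operators.

  S₁≤ : ∀ x → Sᴬ one x ≤ x
  S₁≤ x = trans (x≤x∨y _ _) (reflexive (S₁-∨ x))

  -- The order is read off joins, which `Sᴬ i` preserves: `x ≤ y` makes `x ∨ᴬ y` equal to `y`.
  S-mono : ∀ i {x y} → x ≤ y → Sᴬ i x ≤ Sᴬ i y
  S-mono i {x} {y} x≤y =
    trans (x≤x∨y _ _)
      (reflexive (Eq.trans (Eq.sym (S-∨ i x y))
        (S-cong i (antisym (∨-least x≤y refl) (y≤x∨y _ _)))))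

  S₁≤S₂ : ∀ x → Sᴬ one x ≤ Sᴬ two x
  S₁≤S₂ x = trans (reflexive (Eq.sym (S-S two one x))) (S-mono two (S₁≤ x))

  -- Goes through `Sᴬ one ⊥`, which lies below `⊥` and is fixed by `Sᴬ i`.
  S⊥≤⊥ : ∀ i → Sᴬ i ⊥ ≤ ⊥
  S⊥≤⊥ i =
    trans (S-mono i (minimum _)) (trans (reflexive (S-S i one ⊥)) (S₁≤ ⊥))

  -- At `⊤ ⇒ᴬ ⊤` the axiom `S₁-⇒` gives a meet of two implications of the form `x ⇒ᴬ x`, each equal
  -- to `⊤`.
  S₁⊤≈⊤ : Sᴬ one ⊤ ≈ ⊤
  S₁⊤≈⊤ = antisym (maximum _)
    (trans (∧-greatest (reflexive (Eq.sym ⇨-unit)) (reflexive (Eq.sym ⇨-unit)))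
      (trans (reflexive (Eq.sym (S₁-⇒ ⊤ ⊤))) (S-mono one (maximum _))))

  -- Excluded middle for `Sᴬ one` carries over, because `Sᴬ one` fixes `Sᴬ i x`.
  S-∨-¬ : ∀ i x → Sᴬ i x ∨ᴬ (¬ᴬ (Sᴬ i x)) ≈ ⊤
  S-∨-¬ i x = antisym (maximum _)
    (trans (reflexive (Eq.sym (S₁-∨-¬ (Sᴬ i x))))
      (∨-least (trans (reflexive (S-S one i x)) (x≤x∨y _ _))
        (trans (⇨-relax (reflexive (Eq.sym (S-S one i x))) refl) (y≤x∨y _ _))))

  -- Forcing of chain values and covering by pieces.

  -- Below e, the element x behaves like the constant t of the chain.
  Forces : Carrier → Three → Carrier → Set ℓ₂
  Forces e t x = ∀ i → Decides e (at i t) (Sᴬ i x)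

  Forces-≤ : ∀ {e f} t {x} → e ≤ f → Forces f t x → Forces e t x
  Forces-≤ t e≤f F i = Decides-≤ (at i t) e≤f (F i)

  Forces-≈ : ∀ {e} t {x y} → x ≈ y → Forces e t x → Forces e t y
  Forces-≈ t x≈y F i = Decides-≈ (at i t) (S-cong i x≈y) (F i)

  decided : ∀ {e a b x y} → b ≡ a → y ≈ x → Decides e a x → Decides e b y
  decided {a = a} ≡.refl y≈x = Decides-≈ a (Eq.sym y≈x)

  Forces-∧ : ∀ {e} t u {x y} → Forces e t x → Forces e u y →
             Forces e (t ∧ᵀ u) (x ∧ᴬ y)
  Forces-∧ t u F G i = decided (at-∧ i t u) (S-∧ i _ _)
    (Decides-∧ (at i t) (at i u) (F i) (G i))

  Forces-∨ : ∀ {e} t u {x y} → Forces e t x → Forces e u y →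
             Forces e (t ∨ᵀ u) (x ∨ᴬ y)
  Forces-∨ t u F G i = decided (at-∨ i t u) (S-∨ i _ _)
    (Decides-∨ (at i t) (at i u) (F i) (G i))

  Forces-⇒ : ∀ {e} t u {x y} → Forces e t x → Forces e u y →
             Forces e (t ⇒ᵀ u) (x ⇒ᴬ y)
  Forces-⇒ t u F G one = decided (at-one-⇒ t u) (S₁-⇒ _ _)
    (Decides-∧ (not (at one t) || at one u) (not (at two t) || at two u)
      (Decides-⇒ (at one t) (at one u) (F one) (G one))
      (Decides-⇒ (at two t) (at two u) (F two) (G two)))
  Forces-⇒ t u F G two = decided (at-two-⇒ t u) (S₂-⇒ _ _)
    (Decides-⇒ (at two t) (at two u) (F two) (G two))

  Forces-⊥ : ∀ {e} → Forces e 0F ⊥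
  Forces-⊥ one = transpose-⇨ (trans (x∧y≤y _ _) (S⊥≤⊥ one))
  Forces-⊥ two = transpose-⇨ (trans (x∧y≤y _ _) (S⊥≤⊥ two))

  Forces-S : ∀ {e} j t {x} → Forces e t x → Forces e (Sᵀ j t) (Sᴬ j x)
  Forces-S j t F i = decided (at-S i j t) (S-S i j _) (F j)

  -- Splitting on `Sᴬ one x` and then on `Sᴬ two x` gives three pieces, not four: by `S₁≤S₂`, the
  -- part under `Sᴬ one x` is already under `Sᴬ two x`.
  cover : ∀ {e d} x → (∀ t f → f ≤ e → Forces f t x → f ≤ d) → e ≤ d
  cover x H = split-on (S-∨-¬ one x)
    (H 2F _ (x∧y≤x _ _) λ where
      one → x∧y≤y _ _
      two → trans (x∧y≤y _ _) (S₁≤S₂ x))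
    (split-on (S-∨-¬ two x)
      (H 1F _ (trans (x∧y≤x _ _) (x∧y≤x _ _)) λ where
        one → trans (x∧y≤x _ _) (x∧y≤y _ _)
        two → x∧y≤y _ _)
      (H 0F _ (trans (x∧y≤x _ _) (x∧y≤x _ _)) λ where
        one → trans (x∧y≤x _ _) (x∧y≤y _ _)
        two → x∧y≤y _ _))

  -- The pieces for `x 0` are refined by the remaining elements; what is forced on a piece stays
  -- forced on smaller ones.
  cover-all : ∀ n {e d} (x : ℕ → Carrier) →
    Every n (λ v → ∀ f → f ≤ e →
      (∀ p → p ℕ.< n → Forces f (v p) (x p)) → f ≤ d) →
    e ≤ d
  cover-all zero    x E = E _ refl λ _ ()
  cover-all (suc n) x E = cover (x 0) λ t f f≤e F →
    cover-all n (x ∘ suc) (Every-map n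
      (λ v H g g≤f G → H g (trans g≤f f≤e) λ where
        zero    _         → Forces-≤ t g≤f F
        (suc p) (s<s p<n) → G p p<n)
      (E t))

-- Values of formulas on a piece.

module _ {c ℓ₁ ℓ₂} (M : AlgebraicModel c ℓ₁ ℓ₂) where
  open AlgebraicModel M

  -- Induction on `α`: each `Sᴬ i` distributes over a connective as `at i` does in the chain, so
  -- forced values compose.
  eval-forced : ∀ {n v e} →
    (∀ p → p ℕ.< n → Forces algebra e (v p) (h (var p))) →
    ∀ α → bound α ℕ.≤ n → Forces algebra e (eval v α) (h α)
  eval-forced {v = v} {e} H = go
    where
    go : ∀ α → bound α ℕ.≤ _ → Forces algebra e (eval v α) (h α)
    go (var p) p<n = H p p<n
    go (α ∧ β) b   = Forces-≈ algebra _ (Eq.sym (h-∧ α β))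
      (Forces-∧ algebra _ _ (go α (m⊔n≤o⇒m≤o _ _ b)) (go β (m⊔n≤o⇒n≤o _ _ b)))
    go (α ∨ β) b   = Forces-≈ algebra _ (Eq.sym (h-∨ α β))
      (Forces-∨ algebra _ _ (go α (m⊔n≤o⇒m≤o _ _ b)) (go β (m⊔n≤o⇒n≤o _ _ b)))
    go (α ⇒ β) b   = Forces-≈ algebra _ (Eq.sym (h-⇒ α β))
      (Forces-⇒ algebra _ _ (go α (m⊔n≤o⇒m≤o _ _ b)) (go β (m⊔n≤o⇒n≤o _ _ b)))
    go (¬ α)   b   = Forces-≈ algebra _ (Eq.sym (h-¬ α))
      (Forces-⇒ algebra _ _ (go α b) (Forces-⊥ algebra))
    go (S i α) b   = Forces-≈ algebra _ (Eq.sym (h-S i α))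
      (Forces-S algebra i _ (go α b))

-- The finite test and its correctness.

Valid : List For → For → Valuation → Set
Valid Γ α v = All (λ γ → eval v γ ≡ 2F) Γ → eval v α ≡ 2F

valid? : ∀ Γ α v → Dec (Valid Γ α v)
valid? Γ α v = All.all? (λ γ → eval v γ Fin.≟ 2F) Γ →-dec (eval v α Fin.≟ 2F)

module _ {c ℓ₁ ℓ₂ : Level} {Γ : List For} {α : For} where

  consequence⇒valid : AlgConsequence c ℓ₁ ℓ₂ (λ γ → γ ∈ Γ) α → ∀ v → Valid Γ α v
  consequence⇒valid Γ⊨α v Γ≡2 =
    lower (Γ⊨α (threeModel c ℓ₁ ℓ₂ v) λ γ γ∈Γ → lift (All.lookup Γ≡2 γ∈Γ))

  valid⇒consequence : ∀ n → (∀ {φ} → φ ∈ α ∷ Γ → bound φ ℕ.≤ n) →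
    Every n (Valid Γ α) → AlgConsequence c ℓ₁ ℓ₂ (λ γ → γ ∈ Γ) α
  valid⇒consequence n bounded valid M Γ≈⊤ =
    -- Forcing speaks of `Sᴬ one` and `Sᴬ two` only, so `⊤` is first bounded by `Sᴬ one (h α)`,
    -- which lies below `h α`.
    antisym (maximum _) (trans
      (cover-all algebra n (h ∘ var) (Every-map n local valid))
      (S₁≤ algebra (h α)))
    where
    open AlgebraicModel M

    local : ∀ v → Valid Γ α v → ∀ e → e ≤ ⊤ →
      (∀ p → p ℕ.< n → Forces algebra e (v p) (h (var p))) →
      e ≤ Sᴬ one (h α)
    local v Γ⊨α e _ H with All.all? (λ γ → eval v γ Fin.≟ 2F) Γ
    ... | yes Γ≡2 = ≡.subst (λ t → Decides algebra e (at one t) (Sᴬ one (h α)))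
      (Γ⊨α Γ≡2) (eval-forced M H α (bounded (here ≡.refl)) one)
    -- Some premise `γ` has a chain value other than 1, so `e` lies below the negation of
    -- `Sᴬ one (h γ)`. But `h γ ≈ ⊤` makes `Sᴬ one (h γ)` equal to `⊤`, so `e` is below everything.
    ... | no  Γ≢2
      with γ , γ∈Γ , γ≢2 ← find (¬All⇒Any¬ (λ γ → eval v γ Fin.≟ 2F) Γ Γ≢2) =
      contradictory algebra
        (trans (maximum _) (reflexive
          (Eq.sym (Eq.trans (S-cong one (Γ≈⊤ γ γ∈Γ)) (S₁⊤≈⊤ algebra)))))
        (≡.subst (λ b → Decides algebra e b (Sᴬ one (h γ)))
          (at-one-≢2F (eval v γ) γ≢2)
          (eval-forced M H γ (bounded (there γ∈Γ)) one))

mainTheorem4 : ∀ (c ℓ₁ ℓ₂ : Level) (Γ : List For) (α : For) →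
    Dec (AlgConsequence c ℓ₁ ℓ₂ (λ γ → γ ∈ Γ) α)
mainTheorem4 c ℓ₁ ℓ₂ Γ α =
  map′ (valid⇒consequence n bounded) (every n ∘ consequence⇒valid)
    (every? n (valid? Γ α))
  where
  n : ℕ
  -- Counting `α` along with `Γ` puts the variables of premises and conclusion alike below `n`.
  n = max 0 (map bound (α ∷ Γ))

  bounded : ∀ {φ} → φ ∈ α ∷ Γ → bound φ ℕ.≤ n
  bounded φ∈ = All.lookup (xs≤max 0 (map bound (α ∷ Γ))) (∈-map⁺ bound φ∈)
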